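{- If $G$ is a $k$-creature-free graph and every minimal separator $S$ of $G$ can be dominated by a set of at most $k$ vertices of $G$ not in $S$, then $G$ has at most $|V(G)|^{k^2+2k}$ minimal separators.
   Context: All graphs are finite, simple and undirected; $k$ is a positive integer. $N_G(X)$ denotes the open neighborhood of a vertex set $X$. Two disjoint vertex sets are anti-complete if there is no edge between them. A set $X\subseteq V(G)$ dominates $Y\subseteq V(G)$ if every $y\in Y$ is in $X$ or has a neighbor in $X$. Minimal separator of $G$: a non-empty $S\subseteq V(G)$ such that $G-S$ has at least two distinct connected components $L,R$ with $N_G(L)=N_G(R)=S$. $k$-creature: a tuple $(A,B,\{x_1,\dots,x_k\},\{y_1,\dots,y_k\})$ of mutually disjoint vertex subsets of $V(G)$ (with the $x_i$ distinct and the $y_i$ distinct) such that (i) $G[A]$ and $G[B]$ are connected and $A$ is anti-complete with $B$; (ii) for every $i$, $x_iy_i\in E(G)$, $x_i$ has a neighbor in $A$ and no neighbor in $B$, and $y_i$ has a neighbor in $B$ and no neighbor in $A$; (iii) for $i\ne j$, $x_iy_j\notin E(G)$. $G$ is $k$-creature-free if it contains no $k$-creature. -}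

module Defs where

open import Data.Nat using (ℕ; _≤_)
open import Data.Fin using (Fin)
open import Data.Fin.Subset
  using (Subset; _∈_; _∉_; _⊆_; _∩_; ∁; ∣_∣; Nonempty; Empty)
open import Data.List using (List; length)
open import Data.List.Relation.Unary.All using (All)
open import Data.List.Relation.Unary.Unique.Propositional using (Unique)
open import Data.Product using (∃; _×_)
open import Data.Sum using (_⊎_)
open import Function.Definitions using (Injective)
open import Level using (0ℓ)
open import Relation.Binary using (Rel; Symmetric; Irreflexive; Decidable)
open import Relation.Binary.Construct.Closure.ReflexiveTransitive using (Star)
open import Relation.Binary.PropositionalEquality using (_≡_; _≢_)
open import Relation.Nullary using (¬_)
open import Relation.Unary using (Pred; _≐_)

-- Finite simple graphs on the vertex set Fin n.  Decidable adjacency is what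
-- makes the graph a finite object constructively; classically it is no
-- restriction.
record Graph (n : ℕ) : Set₁ where
  field
    Adj    : Rel (Fin n) 0ℓ
    sym    : Symmetric Adj
    irrefl : Irreflexive _≡_ Adj
    adj?   : Decidable Adj

Disjoint : ∀ {n} → Subset n → Subset n → Set
Disjoint X Y = Empty (X ∩ Y)

module _ {n : ℕ} (G : Graph n) where
  open Graph G

  HasNbrIn : Fin n → Subset n → Set
  HasNbrIn v X = ∃ λ u → u ∈ X × Adj v u

  N : Subset n → Pred (Fin n) 0ℓ
  N X v = v ∉ X × HasNbrIn v X

  AntiComplete : Subset n → Subset n → Set
  AntiComplete X Y = ∀ {u v} → u ∈ X → v ∈ Y → ¬ Adj u v

  Dominates : Subset n → Subset n → Set
  Dominates X Y = ∀ {y} → y ∈ Y → y ∈ X ⊎ HasNbrIn y X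

  -- Adjacency in the induced subgraph G[X].
  InducedAdj : Subset n → Rel (Fin n) 0ℓ
  InducedAdj X u v = u ∈ X × v ∈ X × Adj u v

  -- G[X] is connected; the null graph does not count as connected.
  Connected : Subset n → Set
  Connected X =
    Nonempty X × (∀ {u v} → u ∈ X → v ∈ X → Star (InducedAdj X) u v)

  -- C is the vertex set of a connected component of G[X].
  IsComponent : Subset n → Subset n → Set
  IsComponent X C =
    C ⊆ X × Connected C × (∀ {D} → D ⊆ X → Connected D → C ⊆ D → D ⊆ C)

  record IsMinimalSeparator (S : Subset n) : Set where
    field
      nonempty    : Nonempty S
      L R         : Subset n
      L-component : IsComponent (∁ S) L
      R-component : IsComponent (∁ S) R
      L≢R         : L ≢ R
      N[L]≐S      : N L ≐ (_∈ S)
      N[R]≐S      : N R ≐ (_∈ S)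

  record Creature (k : ℕ) : Set where
    field
      A B  : Subset n
      x y  : Fin k → Fin n

      x-injective : Injective _≡_ _≡_ x
      y-injective : Injective _≡_ _≡_ y

      A-B-disjoint : Disjoint A B
      x∉A          : ∀ i → x i ∉ A
      x∉B          : ∀ i → x i ∉ B
      y∉A          : ∀ i → y i ∉ A
      y∉B          : ∀ i → y i ∉ B
      x≢y          : ∀ i j → x i ≢ y j

      A-connected     : Connected A
      B-connected     : Connected B
      A-B-anticomplete : AntiComplete A B

      x~y        : ∀ i → Adj (x i) (y i)
      x-nbr-A    : ∀ i → HasNbrIn (x i) A
      x-no-nbr-B : ∀ i → ¬ HasNbrIn (x i) B
      y-nbr-B    : ∀ i → HasNbrIn (y i) B
      y-no-nbr-A : ∀ i → ¬ HasNbrIn (y i) A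

      x≁y : ∀ {i j} → i ≢ j → ¬ Adj (x i) (y j)

  CreatureFree : ℕ → Set
  CreatureFree k = ¬ Creature k

  DominatedFromOutside : ℕ → Subset n → Set
  DominatedFromOutside k S =
    ∃ λ X → ∣ X ∣ ≤ k × Disjoint X S × Dominates X S

-- P holds for at most m elements: every duplicate-free list of elements
-- satisfying P has length at most m.
AtMost : ∀ {A : Set} → ℕ → Pred A 0ℓ → Set
AtMost {A} m P = (xs : List A) → Unique xs → All P xs → length xs ≤ m

{-# OPTIONS --safe #-}

-- Let v ∉ S for a minimal separator S = N(L) = N(R).  One of the two sides,
-- say R, avoids v, so the trace S ∩ N(v) equals N(R) ∩ N(v) with v
-- anti-complete to R.  Fix v and a vertex r ∈ R.  If the traces obtained in
-- this way cut out of some k-set {x₁,…,x_k} both the empty set and every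
-- singleton {xᵢ}, via R₀ and Rᵢ, then follow a path in Rᵢ from r to a
-- neighbour of xᵢ until the first vertex yᵢ that has a neighbour among the x's:
-- A = {v} and the union B of these paths without their ends yᵢ form a
-- k-creature.  Hence, by a Sauer–Shelah argument, there are fewer than n^k
-- traces for each pair (v , r).  As S is dominated from outside, it is the
-- union of at most k traces.
module Submission where

open import Defs
open import Data.Fin using (Fin; zero; suc; _≟_)
open import Data.Fin.Properties using (any?; injective⇒≤)
open import Data.Fin.Subset
open import Data.Fin.Subset.Properties
open import Data.List
  using (List; []; _∷_; [_]; length; map; _++_; concatMap; tabulate; allFin;
         lookup; cartesianProductWith)
open import Data.List.Properties
  using (length-++; length-map; length-tabulate)
open import Data.List.Membership.Propositional using (find; lose) renaming (_∈_ to _∈ₗ_)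
open import Data.List.Membership.Propositional.Properties
  using (∈-++⁺ˡ; ∈-++⁺ʳ; ∈-map⁺; ∈-map⁻; ∈-concatMap⁺; ∈-allFin; ∈-lookup;
         ∈-cartesianProductWith⁺)
open import Data.List.Relation.Unary.All as All using (All; []; _∷_)
import Data.List.Relation.Unary.All.Properties as All
open import Data.List.Relation.Unary.Any as Any using (Any; here; there)
import Data.List.Relation.Unary.Any.Properties as Any
open import Data.List.Relation.Unary.Unique.Propositional using (Unique; []; _∷_)
open import Data.Nat
  using (ℕ; zero; suc; NonZero; _+_; _*_; _^_; _≤_; _<_; z≤n; s≤s; >-nonZero)
open import Data.Nat.Properties hiding (_≟_)
open import Data.Nat.Solver using (module +-*-Solver)
open import Algebra.Properties.CommutativeSemigroup +-commutativeSemigroup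
  using (interchange)
import Data.Bool as Bool
import Data.Vec as Vec
open import Data.Vec using ([]; _∷_; here; there)
open import Data.Vec.Properties
  using (≡-dec; lookup⇒[]=; []=⇒lookup; lookup∘tabulate)
open import Data.Product using (∃; _×_; _,_; proj₁; proj₂)
open import Data.Sum using (_⊎_; inj₁; inj₂; [_,_]′)
open import Function using (_∘_; id)
open import Level using (0ℓ)
open import Relation.Binary.Construct.Closure.ReflexiveTransitive as Star
  using (Star; ε; _◅_; _◅◅_)
open import Relation.Binary.PropositionalEquality
  using (_≡_; _≢_; refl; sym; trans; cong; cong₂; subst; module ≡-Reasoning)
open import Relation.Nullary
  using (¬_; yes; no; does; contradiction; ¬?; _×-dec_)
open import Relation.Nullary.Decidable using (dec-true)
open import Relation.Unary using (Pred; Decidable)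
  renaming (_∪_ to _∪ₚ_; _∩_ to _∩ₚ_)
open import Relation.Unary.Properties using (_∪?_; _∩?_)

-- Counting with lists

length-concatMap-≤ : ∀ {A B : Set} (f : A → List B) {c} →
  (∀ a → length (f a) ≤ c) → ∀ xs → length (concatMap f xs) ≤ length xs * c
length-concatMap-≤ f h []       = z≤n
length-concatMap-≤ f {c} h (x ∷ xs) = begin
  length (f x ++ concatMap f xs)         ≡⟨ length-++ (f x) ⟩
  length (f x) + length (concatMap f xs) ≤⟨ +-mono-≤ (h x) (length-concatMap-≤ f h xs) ⟩
  c + length xs * c                      ∎
  where open ≤-Reasoning

length-concatMap-allFin-≤ : ∀ {B : Set} {n} (f : Fin n → List B) {c} →
  (∀ i → length (f i) ≤ c) → length (concatMap f (allFin n)) ≤ n * c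
length-concatMap-allFin-≤ {n = n} f {c} h =
  subst (λ m → length (concatMap f (allFin n)) ≤ m * c) (length-tabulate {n = n} id)
    (length-concatMap-≤ f h (allFin n))

∈-concatMap-allFin : ∀ {B : Set} {n} (f : Fin n → List B) {b} i →
  b ∈ₗ f i → b ∈ₗ concatMap f (allFin n)
∈-concatMap-allFin f i b∈ = ∈-concatMap⁺ f (lose (∈-allFin i) b∈)

length-cartesianProductWith : ∀ {A B C : Set} (f : A → B → C) xs ys →
  length (cartesianProductWith f xs ys) ≡ length xs * length ys
length-cartesianProductWith f []       ys = refl
length-cartesianProductWith f (x ∷ xs) ys =
  trans (length-++ (map (f x) ys))
    (cong₂ _+_ (length-map (f x) ys) (length-cartesianProductWith f xs ys))

lookup-injective : ∀ {A : Set} {xs : List A} → Unique xs →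
  ∀ {i j} → lookup xs i ≡ lookup xs j → i ≡ j
lookup-injective (_   ∷ _)  {zero}  {zero}  _  = refl
lookup-injective (x∉ ∷ _)  {zero}  {suc j} eq = contradiction eq (All.lookup x∉ (∈-lookup j))
lookup-injective (x∉ ∷ _)  {suc i} {zero}  eq = contradiction (sym eq) (All.lookup x∉ (∈-lookup i))
lookup-injective (_   ∷ xs!) {suc i} {suc j} eq = cong suc (lookup-injective xs! eq)

-- Pigeonhole: the position in `ys` of each entry of `xs` defines an injection between the index
-- types.
length-≤-of-⊆ : ∀ {A : Set} {xs ys : List A} → Unique xs →
  (∀ i → lookup xs i ∈ₗ ys) → length xs ≤ length ys
length-≤-of-⊆ {ys = ys} xs! xs⊆ys = injective⇒≤ {f = Any.index ∘ xs⊆ys} λ {i} {j} eq → lookup-injective xs!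
  (trans (Any.lookup-index (xs⊆ys i))
    (trans (cong (lookup ys) eq) (sym (Any.lookup-index (xs⊆ys j)))))

-- Subsets, their elements and their unions

elements : ∀ {n} → Subset n → List (Fin n)
elements []            = []
elements (outside ∷ p) = map suc (elements p)
elements (inside ∷ p)  = zero ∷ map suc (elements p)

length-elements : ∀ {n} (p : Subset n) → length (elements p) ≡ ∣ p ∣
length-elements []            = refl
length-elements (outside ∷ p) = trans (length-map suc (elements p)) (length-elements p)
length-elements (inside ∷ p)  = cong suc (trans (length-map suc (elements p)) (length-elements p))

∈-elements⁺ : ∀ {n} (p : Subset n) {x} → x ∈ p → x ∈ₗ elements p
∈-elements⁺ (inside ∷ p)  here       = here refl
∈-elements⁺ (inside ∷ p)  (there x∈) = there (∈-map⁺ suc (∈-elements⁺ p x∈))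
∈-elements⁺ (outside ∷ p) (there x∈) = ∈-map⁺ suc (∈-elements⁺ p x∈)

∈-elements⁻ : ∀ {n} (p : Subset n) {x} → x ∈ₗ elements p → x ∈ p
∈-elements⁻ (inside ∷ p) (here refl) = here
∈-elements⁻ (inside ∷ p) (there x∈) with ∈-map⁻ suc x∈
... | _ , y∈ , refl = there (∈-elements⁻ p y∈)
∈-elements⁻ (outside ∷ p) x∈ with ∈-map⁻ suc x∈
... | _ , y∈ , refl = there (∈-elements⁻ p y∈)

∈-⋃⁺ : ∀ {n} {x : Fin n} {ps} → Any (x ∈_) ps → x ∈ ⋃ ps
∈-⋃⁺ (here x∈)  = x∈p∪q⁺ (inj₁ x∈)
∈-⋃⁺ (there x∈) = x∈p∪q⁺ (inj₂ (∈-⋃⁺ x∈))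

∈-⋃⁻ : ∀ {n} {x : Fin n} ps → x ∈ ⋃ ps → Any (x ∈_) ps
∈-⋃⁻ []       x∈ = contradiction x∈ ∉⊥
∈-⋃⁻ (p ∷ ps) x∈ = [ here , there ∘ ∈-⋃⁻ ps ]′ (x∈p∪q⁻ p (⋃ ps) x∈)

module _ {n} {P : Pred (Fin n) 0ℓ} (P? : Decidable P) where

  comprehension : Subset n
  comprehension = Vec.tabulate (does ∘ P?)

  ∈-comprehension⁺ : ∀ {x} → P x → x ∈ comprehension
  ∈-comprehension⁺ {x} px =
    lookup⇒[]= x _ (trans (lookup∘tabulate (does ∘ P?) x) (dec-true (P? x) px))

  ∈-comprehension⁻ : ∀ {x} → x ∈ comprehension → P x
  ∈-comprehension⁻ {x} x∈
    with P? x | trans (sym (lookup∘tabulate (does ∘ P?) x)) ([]=⇒lookup x∈)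
  ... | yes px | _  = px
  ... | no  _  | ()

-- `⊥` is offered as a choice in every round, so unions of fewer than `j` members occur as well;
-- this accounts for the `suc` in the length.
unionsUpTo : ∀ {n} → ℕ → List (Subset n) → List (Subset n)
unionsUpTo zero    ts = [ ⊥ ]
unionsUpTo (suc j) ts = cartesianProductWith _∪_ (⊥ ∷ ts) (unionsUpTo j ts)

length-unionsUpTo : ∀ {n} j (ts : List (Subset n)) →
  length (unionsUpTo j ts) ≡ suc (length ts) ^ j
length-unionsUpTo zero    ts = refl
length-unionsUpTo (suc j) ts =
  trans (length-cartesianProductWith _∪_ (⊥ ∷ ts) (unionsUpTo j ts))
    (cong (suc (length ts) *_) (length-unionsUpTo j ts))

⋃-∈-unionsUpTo : ∀ {n} j {ts : List (Subset n)} us → length us ≤ j →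
  All (_∈ₗ ts) us → ⋃ us ∈ₗ unionsUpTo j ts
⋃-∈-unionsUpTo zero    []       _         _          = here refl
⋃-∈-unionsUpTo (suc j) {ts} []  _         _          =
  subst (_∈ₗ unionsUpTo (suc j) ts) (∪-identityˡ ⊥)
    (∈-cartesianProductWith⁺ _∪_ {xs = ⊥ ∷ ts} (here refl) (⋃-∈-unionsUpTo j [] z≤n []))
⋃-∈-unionsUpTo (suc j) (u ∷ us) (s≤s len) (u∈ ∷ us∈) =
  ∈-cartesianProductWith⁺ _∪_ (there u∈) (⋃-∈-unionsUpTo j us len us∈)

-- A Sauer–Shelah bound

-- The recursion splits on the first element of the ground set and lists each member once, so `size`
-- is the cardinality of the family.
enumerate : ∀ {m} {P : Pred (Subset m) 0ℓ} → Decidable P → List (Subset m)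
enumerate {zero}  P? with P? []
... | yes _ = [ [] ]
... | no  _ = []
enumerate {suc m} P? =
  map (outside ∷_) (enumerate (P? ∘ (outside ∷_))) ++
  map (inside ∷_)  (enumerate (P? ∘ (inside ∷_)))

∈-enumerate : ∀ {m} {P : Pred (Subset m) 0ℓ} (P? : Decidable P) {T} →
  P T → T ∈ₗ enumerate P?
∈-enumerate {zero} P? {[]} pT with P? []
... | yes _ = here refl
... | no ¬p = contradiction pT ¬p
∈-enumerate {suc m} P? {outside ∷ T} pT =
  ∈-++⁺ˡ (∈-map⁺ (outside ∷_) (∈-enumerate (P? ∘ (outside ∷_)) pT))
∈-enumerate {suc m} P? {inside ∷ T} pT =
  ∈-++⁺ʳ (map (outside ∷_) (enumerate (P? ∘ (outside ∷_))))
    (∈-map⁺ (inside ∷_) (∈-enumerate (P? ∘ (inside ∷_)) pT))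

size : ∀ {m} {P : Pred (Subset m) 0ℓ} → Decidable P → ℕ
size P? = length (enumerate P?)

size-suc : ∀ {m} {P : Pred (Subset (suc m)) 0ℓ} (P? : Decidable P) →
  size P? ≡ size (P? ∘ (outside ∷_)) + size (P? ∘ (inside ∷_))
size-suc P? = trans (length-++ (map (outside ∷_) (enumerate (P? ∘ (outside ∷_)))))
  (cong₂ _+_ (length-map (outside ∷_) (enumerate (P? ∘ (outside ∷_))))
             (length-map (inside ∷_) (enumerate (P? ∘ (inside ∷_)))))

size-∅ : ∀ {m} {P : Pred (Subset m) 0ℓ} (P? : Decidable P) →
  (∀ T → ¬ P T) → size P? ≡ 0
size-∅ {zero} P? ¬P with P? []
... | yes p = contradiction p (¬P [])
... | no  _ = refl
size-∅ {suc m} P? ¬P = trans (size-suc P?)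
  (cong₂ _+_ (size-∅ (P? ∘ (outside ∷_)) (¬P ∘ (outside ∷_)))
             (size-∅ (P? ∘ (inside ∷_)) (¬P ∘ (inside ∷_))))

-- Inclusion-exclusion. Applied to the two halves of a family, it trades their sizes for those of a
-- union and an intersection on a smaller ground set, as the Sauer-Shelah induction requires.
size-∪-∩ : ∀ {m} {P Q : Pred (Subset m) 0ℓ} (P? : Decidable P) (Q? : Decidable Q) →
  size P? + size Q? ≡ size (P? ∪? Q?) + size (P? ∩? Q?)
size-∪-∩ {zero} P? Q? with P? [] | Q? []
... | yes _ | yes _ = refl
... | yes _ | no  _ = refl
... | no  _ | yes _ = refl
... | no  _ | no  _ = refl
size-∪-∩ {suc m} P? Q? = begin
  size P? + size Q?
    ≡⟨ cong₂ _+_ (size-suc P?) (size-suc Q?) ⟩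
  (size P₀ + size P₁) + (size Q₀ + size Q₁)
    ≡⟨ interchange (size P₀) (size P₁) (size Q₀) (size Q₁) ⟩
  (size P₀ + size Q₀) + (size P₁ + size Q₁)
    ≡⟨ cong₂ _+_ (size-∪-∩ P₀ Q₀) (size-∪-∩ P₁ Q₁) ⟩
  (size (P₀ ∪? Q₀) + size (P₀ ∩? Q₀)) + (size (P₁ ∪? Q₁) + size (P₁ ∩? Q₁))
    ≡⟨ interchange (size (P₀ ∪? Q₀)) (size (P₀ ∩? Q₀)) (size (P₁ ∪? Q₁)) (size (P₁ ∩? Q₁)) ⟩
  (size (P₀ ∪? Q₀) + size (P₁ ∪? Q₁)) + (size (P₀ ∩? Q₀) + size (P₁ ∩? Q₁))
    ≡⟨ sym (cong₂ _+_ (size-suc (P? ∪? Q?)) (size-suc (P? ∩? Q?))) ⟩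
  size (P? ∪? Q?) + size (P? ∩? Q?) ∎
  where
  open ≡-Reasoning
  P₀ = P? ∘ (outside ∷_)
  P₁ = P? ∘ (inside ∷_)
  Q₀ = Q? ∘ (outside ∷_)
  Q₁ = Q? ∘ (inside ∷_)

-- Weaker than shattering {x₀,…,x_{k-1}}: only the traces ∅ and {xᵢ} are
-- required.
StarShatters : ℕ → ∀ {m} → Pred (Subset m) 0ℓ → Set
StarShatters k {m} P = ∃ λ (x : Fin k → Fin m) →
  (∃ λ T → P T × (∀ j → x j ∉ T)) ×
  (∀ i → ∃ λ T → P T × x i ∈ T × (∀ j → j ≢ i → x j ∉ T))

module _ {m} {P : Pred (Subset (suc m)) 0ℓ} where

  -- The dropped element is not among the points, so its bit in each lifted set is arbitrary.
  starShatters-∪ : ∀ {k} →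
    StarShatters k ((P ∘ (outside ∷_)) ∪ₚ (P ∘ (inside ∷_))) → StarShatters k P
  starShatters-∪ (x , (T , pT , x∉T) , single) =
    suc ∘ x , (_ , proj₂ (extend pT) , λ j → x∉T j ∘ drop-there) ,
    λ i → let (T , pT , xi∈T , x∉T) = single i in
      _ , proj₂ (extend pT) , there xi∈T , λ j j≢i → x∉T j j≢i ∘ drop-there
    where
    extend : ∀ {T} → P (outside ∷ T) ⊎ P (inside ∷ T) → ∃ λ s → P (s ∷ T)
    extend = [ outside ,_ , inside ,_ ]′

  -- A set in the intersection extends both with and without the first element, which therefore
  -- joins the points: adding it to the set that misses all `x j` cuts out its singleton.
  starShatters-∩ : ∀ {k} →
    StarShatters k ((P ∘ (outside ∷_)) ∩ₚ (P ∘ (inside ∷_))) → StarShatters (suc k) P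
  starShatters-∩ {k} (x , (T , (p₀ , p₁) , x∉T) , single) =
    x′ ,
    (outside ∷ T , p₀ , λ { zero () ; (suc j) → x∉T j ∘ drop-there }) ,
    single′
    where
    x′ : Fin (suc k) → Fin (suc m)
    x′ zero    = zero
    x′ (suc i) = suc (x i)

    single′ : ∀ i → ∃ λ T → P T × x′ i ∈ T × (∀ j → j ≢ i → x′ j ∉ T)
    single′ zero = inside ∷ T , p₁ , here , λ where
      zero    0≢0 → contradiction refl 0≢0
      (suc j) _   → x∉T j ∘ drop-there
    single′ (suc i) with single i
    ... | T , (p₀ , _) , xi∈T , x∉T = outside ∷ T , p₀ , there xi∈T , λ where
      zero    _   ()
      (suc j) j≢i → x∉T j (j≢i ∘ cong suc) ∘ drop-there

-- The sum 1 + m + ... + m^(k-1), in Horner form.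
geometric : ℕ → ℕ → ℕ
geometric m zero    = 0
geometric m (suc k) = suc (m * geometric m k)

geometric-mono : ∀ m k → geometric m k ≤ geometric (suc m) k
geometric-mono m zero    = z≤n
geometric-mono m (suc k) = s≤s (*-mono-≤ (n≤1+n m) (geometric-mono m k))

geometric<^ : ∀ {m} → 2 ≤ m → ∀ k → geometric m k < m ^ k
geometric<^ 2≤m zero = s≤s z≤n
geometric<^ {m} 2≤m (suc k) = begin
  -- One unit comes from the leading 1 of the sum, the other from the strict inequality; `m` absorbs
  -- both.
  2 + m * geometric m k   ≤⟨ +-monoˡ-≤ _ 2≤m ⟩
  m + m * geometric m k   ≡⟨ sym (*-suc m (geometric m k)) ⟩
  m * suc (geometric m k) ≤⟨ *-monoʳ-≤ m (geometric<^ 2≤m k) ⟩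
  m * m ^ k               ∎
  where open ≤-Reasoning

-- Induction on the ground set: the union of the two halves star-shatters no `suc k` points, and
-- their intersection no `k` points.
sauer : ∀ k {m} {P : Pred (Subset m) 0ℓ} (P? : Decidable P) →
  ¬ StarShatters k P → size P? ≤ geometric m k
-- With no points to cut out, star-shattering only asks for a member, so the family is empty.
sauer zero P? ¬star = ≤-reflexive (size-∅ P? λ T pT →
  ¬star ((λ ()) , (T , pT , λ ()) , λ ()))
sauer (suc k) {zero} P? ¬star with P? []
... | yes _ = s≤s z≤n
... | no  _ = z≤n
sauer (suc k) {suc m} P? ¬star = begin
  size P?
    ≡⟨ trans (size-suc P?) (size-∪-∩ P₀ P₁) ⟩
  size (P₀ ∪? P₁) + size (P₀ ∩? P₁)
    ≤⟨ +-mono-≤ (sauer (suc k) (P₀ ∪? P₁) (¬star ∘ starShatters-∪))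
                (sauer k (P₀ ∩? P₁) (¬star ∘ starShatters-∩)) ⟩
  suc (m * geometric m k) + geometric m k
    ≡⟨ cong suc (+-comm (m * geometric m k) (geometric m k)) ⟩
  suc (suc m * geometric m k)
    ≤⟨ s≤s (*-monoʳ-≤ (suc m) (geometric-mono m k)) ⟩
  suc (suc m * geometric (suc m) k) ∎
  where
  open ≤-Reasoning
  P₀ = P? ∘ (outside ∷_)
  P₁ = P? ∘ (inside ∷_)

-- Connectivity in induced subgraphs

module _ {n : ℕ} (G : Graph n) where
  open Graph G renaming (sym to adj-sym)

  neighbourhood : Fin n → Subset n
  neighbourhood v = comprehension (adj? v)

  induced-sym : ∀ {X u v} → InducedAdj G X u v → InducedAdj G X v u
  induced-sym (u∈ , v∈ , uv) = v∈ , u∈ , adj-sym uv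

  induced-mono : ∀ {X Y} → X ⊆ Y → ∀ {u v} →
    Star (InducedAdj G X) u v → Star (InducedAdj G Y) u v
  induced-mono X⊆Y = Star.map λ (u∈ , v∈ , uv) → X⊆Y u∈ , X⊆Y v∈ , uv

  connected-from : ∀ {X r} → r ∈ X →
    (∀ {u} → u ∈ X → Star (InducedAdj G X) r u) → Connected G X
  connected-from r∈X reach =
    (_ , r∈X) , λ u∈ v∈ → Star.reverse induced-sym (reach u∈) ◅◅ reach v∈

  ⁅⁆-connected : ∀ v → Connected G ⁅ v ⁆
  ⁅⁆-connected v = connected-from (x∈⁅x⁆ v) λ u∈ →
    subst (Star _ v) (sym (x∈⁅y⁆⇒x≡y v u∈)) ε

  ⋃-connected : ∀ {r} p ps → All (λ X → Connected G X × r ∈ X) (p ∷ ps) →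
    Connected G (⋃ (p ∷ ps))
  ⋃-connected p ps conn =
    connected-from (∈-⋃⁺ {ps = p ∷ ps} (here (proj₂ (All.head conn)))) λ u∈ →
      reach conn id (∈-⋃⁻ (p ∷ ps) u∈)
    where
    -- The recursion runs over `qs` while the union that contains the walk stays fixed.
    reach : ∀ {r u qs} → All (λ X → Connected G X × r ∈ X) qs →
      (∀ {w} → Any (w ∈_) qs → Any (w ∈_) (p ∷ ps)) → Any (u ∈_) qs →
      Star (InducedAdj G (⋃ (p ∷ ps))) r u
    reach ((c , r∈) ∷ _) qs⊆ (here u∈) =
      induced-mono (∈-⋃⁺ ∘ qs⊆ ∘ here) (proj₂ c r∈ u∈)
    reach (_ ∷ cs) qs⊆ (there u∈) = reach cs (qs⊆ ∘ there) u∈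

  ∪-connected : ∀ {X Y r} → Connected G X → Connected G Y → r ∈ X → r ∈ Y →
    Connected G (X ∪ Y)
  ∪-connected {X} {Y} cX cY r∈X r∈Y =
    subst (λ Z → Connected G (X ∪ Z)) (∪-identityʳ Y)
      (⋃-connected X (Y ∷ []) ((cX , r∈X) ∷ (cY , r∈Y) ∷ []))

  -- The union of two connected sets that share `r` is connected, so maximality puts it inside each
  -- component.
  component-unique : ∀ {X C D r} → IsComponent G X C → IsComponent G X D →
    r ∈ C → r ∈ D → C ≡ D
  component-unique {X} {C} {D} (C⊆X , cC , maxC) (D⊆X , cD , maxD) r∈C r∈D =
    ⊆-antisym (maxD C∪D⊆X C∪D-connected (q⊆p∪q C D) ∘ p⊆p∪q D)
              (maxC C∪D⊆X C∪D-connected (p⊆p∪q D) ∘ q⊆p∪q C D)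
    where
    C∪D⊆X : (C ∪ D) ⊆ X
    C∪D⊆X x∈ = [ C⊆X , D⊆X ]′ (x∈p∪q⁻ C D x∈)
    C∪D-connected = ∪-connected cC cD r∈C r∈D

  -- The outcome of following a walk in `R` from `r` until just before its first bad vertex `hit`.
  -- Only the vertex set is kept, as the creature needs no order on it.
  record FirstHit (Bad : Pred (Fin n) 0ℓ) (R : Subset n) (r : Fin n) : Set where
    field
      path           : Subset n
      path-connected : Connected G path
      r∈path         : r ∈ path
      path⊆R         : path ⊆ R
      path-good      : ∀ {u} → u ∈ path → ¬ Bad u
      hit            : Fin n
      hit∈R          : hit ∈ R
      hit-bad        : Bad hit
      hit-nbr        : HasNbrIn G hit path

  firstHit : ∀ {Bad} → Decidable Bad → ∀ {R r z} → ¬ Bad r → Bad z →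
    Star (InducedAdj G R) r z → FirstHit Bad R r
  firstHit Bad? good bad ε = contradiction bad good
  firstHit {Bad} Bad? {R} {r} good bad (_◅_ {j = w} (r∈R , w∈R , rw) walk) with Bad? w
  ... | yes w-bad = record
    { path           = ⁅ r ⁆
    ; path-connected = ⁅⁆-connected r
    ; r∈path         = x∈⁅x⁆ r
    ; path⊆R         = λ u∈ → subst (_∈ R) (sym (x∈⁅y⁆⇒x≡y r u∈)) r∈R
    ; path-good      = λ u∈ → subst (¬_ ∘ Bad) (sym (x∈⁅y⁆⇒x≡y r u∈)) good
    ; hit            = w
    ; hit∈R          = w∈R
    ; hit-bad        = w-bad
    ; hit-nbr        = r , x∈⁅x⁆ r , adj-sym rw
    }
  ... | no w-good = record
    { path           = path′
    ; path-connected = connected-from r∈path′ λ u∈ →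
        [ (λ u∈r → subst (Star _ r) (sym (x∈⁅y⁆⇒x≡y r u∈r)) ε)
        , (λ u∈p → (r∈path′ , q⊆p∪q ⁅ r ⁆ path r∈path , rw) ◅
                   induced-mono (q⊆p∪q ⁅ r ⁆ path) (proj₂ path-connected r∈path u∈p))
        ]′ (x∈p∪q⁻ ⁅ r ⁆ path u∈)
    ; r∈path         = r∈path′
    ; path⊆R         = λ u∈ →
        [ (λ u∈r → subst (_∈ R) (sym (x∈⁅y⁆⇒x≡y r u∈r)) r∈R) , path⊆R
        ]′ (x∈p∪q⁻ ⁅ r ⁆ path u∈)
    ; path-good      = λ u∈ →
        [ (λ u∈r → subst (¬_ ∘ Bad) (sym (x∈⁅y⁆⇒x≡y r u∈r)) good) , path-good
        ]′ (x∈p∪q⁻ ⁅ r ⁆ path u∈)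
    ; hit            = hit
    ; hit∈R          = hit∈R
    ; hit-bad        = hit-bad
    ; hit-nbr        = let (u , u∈ , a) = hit-nbr in u , q⊆p∪q ⁅ r ⁆ path u∈ , a
    }
    where
    open FirstHit (firstHit Bad? w-good bad walk)
    path′ : Subset n
    path′ = ⁅ r ⁆ ∪ path
    r∈path′ : r ∈ path′
    r∈path′ = p⊆p∪q path (x∈⁅x⁆ r)

  -- Creatures from star-shattered traces

  -- The last three fields say that `T` is N(v) ∩ N(R).
  record Trace (v r : Fin n) (T : Subset n) : Set where
    field
      R           : Subset n
      R-connected : Connected G R
      r∈R         : r ∈ R
      v∉R         : v ∉ R
      v-no-nbr-R  : ¬ HasNbrIn G v R
      T⊆N[v]      : ∀ {u} → u ∈ T → Adj v u
      T⊆N[R]      : ∀ {u} → u ∈ T → HasNbrIn G u R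
      N[v]∩N[R]⊆T : ∀ {u} → Adj v u → HasNbrIn G u R → u ∈ T

  creature : ∀ k .{{_ : NonZero k}} {v r} {P : Pred (Subset n) 0ℓ} →
    (∀ {T} → P T → Trace v r T) → StarShatters k P → Creature G k
  -- `B` is a union of `k` paths, and it is non-empty only if there is at least one.
  creature k@(suc _) {v} {r} P⇒Trace (x , (T₀ , pT₀ , x∉T₀) , single) = record
    { A = ⁅ v ⁆
    ; B = B
    ; x = x
    ; y = y
    ; x-injective = λ {i} {j} → x-injective i j
    ; y-injective = λ {i} {j} → y-injective i j
    ; A-B-disjoint = λ (w , w∈) → let (w∈v , w∈B) = x∈p∩q⁻ ⁅ v ⁆ B w∈ in
        v∉B (subst (_∈ B) (x∈⁅y⁆⇒x≡y v w∈v) w∈B)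
    ; x∉A = λ i xi∈v → irrefl (sym (x∈⁅y⁆⇒x≡y v xi∈v)) (v~x i)
    ; x∉B = λ i xi∈B → let (j , xi∈) = ∈B⁻ xi∈B in x∉R i j (path⊆R j xi∈)
    ; y∉A = λ i yi∈v → Tr.v∉R i (subst (_∈ Tr.R i) (x∈⁅y⁆⇒x≡y v yi∈v) (y∈R i))
    ; y∉B = λ i yi∈B → B-good yi∈B (Hit.hit-bad i)
    ; x≢y = λ i j eq → x∉R i j (subst (_∈ Tr.R j) (sym eq) (y∈R j))
    ; A-connected = ⁅⁆-connected v
    ; B-connected = B-connected
    ; A-B-anticomplete = λ u∈v w∈B uw → let (i , w∈) = ∈B⁻ w∈B in
        Tr.v-no-nbr-R i (_ , path⊆R i w∈ , subst (λ u → Adj u _) (x∈⁅y⁆⇒x≡y v u∈v) uw)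
    ; x~y = x~y
    ; x-nbr-A = λ i → v , x∈⁅x⁆ v , adj-sym (v~x i)
    ; x-no-nbr-B = λ i (u , u∈B , xu) → B-good u∈B (i , xu)
    ; y-nbr-B = λ i → let (u , u∈ , yu) = Hit.hit-nbr i in u , ∈B⁺ i u∈ , yu
    ; y-no-nbr-A = λ i (u , u∈v , yu) → Tr.v-no-nbr-R i
        (y i , y∈R i , adj-sym (subst (Adj (y i)) (x∈⁅y⁆⇒x≡y v u∈v) yu))
    ; x≁y = λ {i} {j} i≢j xy → x-far j i i≢j (y j , y∈R j , xy)
    }
    where
    T : Fin k → Subset n
    T i = proj₁ (single i)
    x∈T : ∀ i → x i ∈ T i
    x∈T i = proj₁ (proj₂ (proj₂ (single i)))
    x∉T : ∀ i j → j ≢ i → x j ∉ T i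
    x∉T i = proj₂ (proj₂ (proj₂ (single i)))

    module Tr₀ = Trace (P⇒Trace pT₀)
    module Tr (i : Fin k) = Trace (P⇒Trace (proj₁ (proj₂ (single i))))

    v~x : ∀ i → Adj v (x i)
    v~x i = Tr.T⊆N[v] i (x∈T i)

    x∉R : ∀ i j → x i ∉ Tr.R j
    x∉R i j xi∈R = Tr.v-no-nbr-R j (x i , xi∈R , v~x i)

    -- A neighbour in `Tr.R i` would put `x j`, which is adjacent to `v`, into the trace that
    -- contains only `x i` among the points.
    x-far : ∀ i j → j ≢ i → ¬ HasNbrIn G (x j) (Tr.R i)
    x-far i j j≢i = x∉T i j j≢i ∘ Tr.N[v]∩N[R]⊆T i (v~x j)

    Bad : Pred (Fin n) 0ℓ
    Bad u = ∃ λ i → Adj (x i) u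

    -- The empty trace serves here: a point adjacent to `r`, which also lies in `Tr₀.R`, would
    -- belong to `T₀`. Hence every walk from `r` starts at a good vertex.
    r-good : ¬ Bad r
    r-good (i , xr) = x∉T₀ i (Tr₀.N[v]∩N[R]⊆T (v~x i) (r , Tr₀.r∈R , xr))

    hits : ∀ i → FirstHit Bad (Tr.R i) r
    hits i = let (u , u∈R , xu) = Tr.T⊆N[R] i (x∈T i) in
      firstHit (λ w → any? λ j → adj? (x j) w) r-good (i , xu)
        (proj₂ (Tr.R-connected i) (Tr.r∈R i) u∈R)

    module Hit (i : Fin k) = FirstHit (hits i)
    open Hit using (path⊆R) renaming (hit to y; hit∈R to y∈R)

    x~y : ∀ i → Adj (x i) (y i)
    -- Being bad only gives an edge to some `x j`; as `y i` lies in `Tr.R i`, `x-far` forces `j` to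
    -- be `i`.
    x~y i with Hit.hit-bad i
    ... | j , xy with j ≟ i
    ...   | yes refl = xy
    ...   | no j≢i   = contradiction (y i , y∈R i , xy) (x-far i j j≢i)

    -- Distinctness follows from the sets `T i`, each of which contains `x i` and no point of
    -- another index.
    x-injective : ∀ i j → x i ≡ x j → i ≡ j
    x-injective i j eq with j ≟ i
    ... | yes refl = refl
    ... | no j≢i   = contradiction (subst (_∈ T i) eq (x∈T i)) (x∉T i j j≢i)

    y-injective : ∀ i j → y i ≡ y j → i ≡ j
    y-injective i j eq with j ≟ i
    ... | yes refl = refl
    ... | no j≢i   = contradiction
      (y i , y∈R i , subst (Adj (x j)) (sym eq) (x~y j)) (x-far i j j≢i)

    B : Subset n
    B = ⋃ (tabulate Hit.path)

    ∈B⁺ : ∀ i {u} → u ∈ Hit.path i → u ∈ B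
    ∈B⁺ i u∈ = ∈-⋃⁺ (Any.tabulate⁺ {f = Hit.path} i u∈)

    ∈B⁻ : ∀ {u} → u ∈ B → ∃ λ i → u ∈ Hit.path i
    ∈B⁻ = Any.tabulate⁻ ∘ ∈-⋃⁻ (tabulate Hit.path)

    v∉B : v ∉ B
    v∉B v∈B = let (i , v∈) = ∈B⁻ v∈B in Tr.v∉R i (path⊆R i v∈)

    B-good : ∀ {u} → u ∈ B → ¬ Bad u
    B-good u∈B = let (i , u∈) = ∈B⁻ u∈B in Hit.path-good i u∈

    B-connected : Connected G B
    B-connected = ⋃-connected (Hit.path zero) (tabulate (Hit.path ∘ suc))
      (All.tabulate⁺ {f = Hit.path} λ i → Hit.path-connected i , Hit.r∈path i)

  -- Minimal separators

  module AvoidingSide {S : Subset n} (sep : IsMinimalSeparator G S) (v : Fin n) where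
    open IsMinimalSeparator sep

    -- Distinct components are disjoint, so `v` misses `L` or `R`. The last two conditions, together
    -- with R ⊆ ∁ S, say N(R) = S.
    avoiding : ∃ λ R → IsComponent G (∁ S) R × v ∉ R ×
      (∀ {u} → u ∈ S → HasNbrIn G u R) × (∀ {u} → u ∉ R → HasNbrIn G u R → u ∈ S)
    avoiding with v ∈? L
    ... | no v∉L = L , L-component , v∉L ,
      proj₂ ∘ proj₂ N[L]≐S , λ u∉ nbr → proj₁ N[L]≐S (u∉ , nbr)
    ... | yes v∈L = R , R-component ,
      (λ v∈R → L≢R (component-unique L-component R-component v∈L v∈R)) ,
      proj₂ ∘ proj₂ N[R]≐S , λ u∉ nbr → proj₁ N[R]≐S (u∉ , nbr)

    -- The witness of non-emptiness carried by the avoiding side. Being computed from the separator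
    -- and `v`, it sorts the traces at `v` into at most `n` classes.
    root : Fin n
    root = proj₁ (proj₁ (proj₁ (proj₂ (proj₁ (proj₂ avoiding)))))

    trace : v ∉ S → Trace v root (S ∩ neighbourhood v)
    trace v∉S with avoiding
    ... | R , (R⊆∁S , conn@((_ , r∈R) , _) , _) , v∉R , S⊆N , N⊆S = record
      { R           = R
      ; R-connected = conn
      ; r∈R         = r∈R
      ; v∉R         = v∉R
      ; v-no-nbr-R  = v∉S ∘ N⊆S v∉R
      ; T⊆N[v]      = λ u∈ → ∈-comprehension⁻ (adj? v) (proj₂ (x∈p∩q⁻ S _ u∈))
      ; T⊆N[R]      = λ u∈ → S⊆N (proj₁ (x∈p∩q⁻ S _ u∈))
      ; N[v]∩N[R]⊆T = λ vu nbr → x∈p∩q⁺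
          -- Were `u` in `R`, its neighbour `v` would lie in N(R) = S.
          ( N⊆S (λ u∈R → v∉S (N⊆S v∉R (_ , u∈R , vu))) nbr
          , ∈-comprehension⁺ (adj? v) vu )
      }

  -- A vertex of `S` and a vertex of `L` are distinct. The bound is what `geometric<^` asks for.
  minimalSeparator⇒2≤n : ∀ {S} → IsMinimalSeparator G S → 2 ≤ n
  minimalSeparator⇒2≤n sep = two (proj₂ nonempty)
    (x∈∁p⇒x∉p (proj₁ L-component (proj₂ (proj₁ (proj₁ (proj₂ L-component))))))
    where
    open IsMinimalSeparator sep
    two : ∀ {m} {X : Subset m} {u w} → u ∈ X → w ∉ X → 2 ≤ m
    two {X = _ ∷ []} {zero} {zero} u∈X u∉X = contradiction u∈X u∉X
    two {X = _ ∷ _ ∷ _} _ _ = s≤s (s≤s z≤n)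

  -- Counting separators as unions of traces

  module _ (k : ℕ) .{{_ : NonZero k}} (free : CreatureFree G k) {m : ℕ}
    (S : Fin m → Subset n) (sep : ∀ i → IsMinimalSeparator G (S i)) (2≤n : 2 ≤ n) where

    -- Only traces of the listed separators count, so that membership is decided by searching the
    -- indices; `sauer` takes a decidable family.
    IsTrace : Fin n → Fin n → Pred (Subset n) 0ℓ
    IsTrace v r T = ∃ λ i →
      v ∉ S i × AvoidingSide.root (sep i) v ≡ r × T ≡ S i ∩ neighbourhood v

    isTrace? : ∀ v r → Decidable (IsTrace v r)
    isTrace? v r T = any? λ i →
      ¬? (v ∈? S i) ×-dec (AvoidingSide.root (sep i) v ≟ r ×-dec
        ≡-dec Bool._≟_ T (S i ∩ neighbourhood v))

    isTrace⇒Trace : ∀ {v r T} → IsTrace v r T → Trace v r T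
    isTrace⇒Trace {v} (i , v∉S , refl , refl) = AvoidingSide.trace (sep i) v v∉S

    traces : List (Subset n)
    traces = concatMap (λ v → concatMap (λ r → enumerate (isTrace? v r)) (allFin n)) (allFin n)

    -- There are `n` choices of `v`, `n` of `r` and fewer than n^k traces for each pair; strictness
    -- makes room for the extra `⊥` in `unionsUpTo`.
    length-traces : suc (length traces) ≤ n ^ (2 + k)
    length-traces = begin-strict
      length traces
        ≤⟨ length-concatMap-allFin-≤ _ (λ v → length-concatMap-allFin-≤ _ λ r →
             sauer k (isTrace? v r) (free ∘ creature k isTrace⇒Trace)) ⟩
      n * (n * geometric n k)
        <⟨ *-monoʳ-< n (*-monoʳ-< n (geometric<^ 2≤n k)) ⟩
      n * (n * n ^ k) ∎
      where
      open ≤-Reasoning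
      instance
        n≢0 : NonZero n
        n≢0 = >-nonZero (≤-trans (s≤s z≤n) 2≤n)

    S∩N[v]∈traces : ∀ i v → v ∉ S i → (S i ∩ neighbourhood v) ∈ₗ traces
    S∩N[v]∈traces i v v∉S = ∈-concatMap-allFin _ v
      (∈-concatMap-allFin _ (AvoidingSide.root (sep i) v)
        (∈-enumerate (isTrace? v _) (i , v∉S , refl , refl)))

    -- As the dominating set `X` avoids `S i`, each vertex of `S i` has a neighbour in `X`, so `S i`
    -- is the union of its traces at the at most `k` vertices of `X`.
    S∈unions : ∀ i → DominatedFromOutside G k (S i) → S i ∈ₗ unionsUpTo k traces
    S∈unions i (X , ∣X∣≤k , X∩S=∅ , X-dominates) =
      subst (_∈ₗ unionsUpTo k traces) (⊆-antisym ⋃⊆S S⊆⋃)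
        (⋃-∈-unionsUpTo k (map T (elements X))
          (≤-trans (≤-reflexive (trans (length-map T (elements X)) (length-elements X))) ∣X∣≤k)
          (All.map⁺ (All.tabulate λ x∈ → S∩N[v]∈traces i _
            (X-outside (∈-elements⁻ X x∈)))))
      where
      T : Fin n → Subset n
      T v = S i ∩ neighbourhood v

      X-outside : ∀ {v} → v ∈ X → v ∉ S i
      X-outside v∈X v∈S = X∩S=∅ (_ , x∈p∩q⁺ (v∈X , v∈S))

      ⋃⊆S : ⋃ (map T (elements X)) ⊆ S i
      ⋃⊆S u∈ = let (_ , _ , u∈T) = find (Any.map⁻ (∈-⋃⁻ (map T (elements X)) u∈)) in
        proj₁ (x∈p∩q⁻ (S i) _ u∈T)

      S⊆⋃ : S i ⊆ ⋃ (map T (elements X))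
      S⊆⋃ u∈S with X-dominates u∈S
      ... | inj₁ u∈X = contradiction u∈S (X-outside u∈X)
      ... | inj₂ (v , v∈X , uv) = ∈-⋃⁺ (Any.map⁺ (lose (∈-elements⁺ X v∈X)
        (x∈p∩q⁺ (u∈S , ∈-comprehension⁺ (adj? v) (adj-sym uv)))))

    length-unions : length (unionsUpTo k traces) ≤ n ^ (k ^ 2 + 2 * k)
    length-unions = begin
      length (unionsUpTo k traces) ≡⟨ length-unionsUpTo k traces ⟩
      suc (length traces) ^ k      ≤⟨ ^-monoˡ-≤ k length-traces ⟩
      (n ^ (2 + k)) ^ k            ≡⟨ ^-*-assoc n (2 + k) k ⟩
      n ^ ((2 + k) * k)            ≡⟨ cong (n ^_) ([2+k]*k≡k^2+2k k) ⟩
      n ^ (k ^ 2 + 2 * k)          ∎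
      where
      open ≤-Reasoning
      [2+k]*k≡k^2+2k : ∀ k → (2 + k) * k ≡ k ^ 2 + 2 * k
      [2+k]*k≡k^2+2k = solve 1 (λ k → (con 2 :+ k) :* k := k :^ 2 :+ con 2 :* k) refl
        where open +-*-Solver

corollary2 : (k : ℕ) .{{_ : NonZero k}} {n : ℕ} (G : Graph n) →
    CreatureFree G k →
    (∀ S → IsMinimalSeparator G S → DominatedFromOutside G k S) →
    AtMost (n ^ (k ^ 2 + 2 * k)) (IsMinimalSeparator G)
corollary2 k G free dominated []           _   _    = z≤n
-- A first separator supplies `2≤n`, hence the separate case of the empty list. The family of
-- separators is the list itself, indexed by position.
corollary2 k G free dominated xs@(S₀ ∷ _) xs! seps@(sep₀ ∷ _) =
  ≤-trans
    (length-≤-of-⊆ xs! λ i →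
      S∈unions G k free (lookup xs) sep 2≤n i (dominated _ (sep i)))
    (length-unions G k free (lookup xs) sep 2≤n)
  where
  sep : ∀ i → IsMinimalSeparator G (lookup xs i)
  sep i = All.lookup seps (∈-lookup i)
  2≤n = minimalSeparator⇒2≤n G sep₀
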